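{- The logic $\mathsf{iCB}:=\mathsf{iCC}\oplus(((p>q)\wedge(q>p)\wedge(p>r))\to(q>r))\oplus((p>q)\to(p>(p>q)))$ is sound and complete with respect to the class of cautious conditional frames $(X,\le,\mathcal R)$ that additionally satisfy, for all $x\in X$ and upsets $a,b$: (i) if $R_a[x]\subseteq b$ and $R_b[x]\subseteq a$ then ${\uparrow}R_a[x]={\uparrow}R_b[x]$; (ii) whenever $xR_ay$ and $yR_az$ there is $w$ with $xR_aw$ and $w\le z$.
   Context: Formulas: $\phi::=p\mid\bot\mid\phi\wedge\phi\mid\phi\vee\phi\mid\phi\to\phi\mid\phi>\phi$, $\top:=\bot\to\bot$. $\mathsf{ICK}\oplus\Gamma$ is the smallest set of formulas containing the axioms of intuitionistic propositional logic, $\Gamma$, $(p>(q\wedge r))\leftrightarrow((p>q)\wedge(p>r))$ and $(p>\top)\leftrightarrow\top$, closed under uniform substitution, modus ponens and: from $\phi\leftrightarrow\psi$ infer $(\phi>\chi)\leftrightarrow(\psi>\chi)$ and $(\chi>\phi)\leftrightarrow(\chi>\psi)$. $\mathsf{iCC}:=\mathsf{ICK}\oplus(p>p)\oplus(((p>q)\wedge((p\wedge q)>r))\to(p>r))\oplus(((p>q)\wedge(p>r))\to((p\wedge q)>r))$. A conditional Kripke frame is $(X,\le,\mathcal R)$, $(X,\le)$ a nonempty preorder, $\mathcal R=\{R_a: a\text{ upset}\}$ such that $x\le yR_az$ implies $xR_aw\le z$ for some $w$; $R_a[x]=\{y:xR_ay\}$, ${\uparrow}S=\{y:\exists s\in S,\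 s\le y\}$. It is cautious if for all $x$ and upsets $a,b$: $R_a[x]\subseteq a$, and $R_a[x]\subseteq b\subseteq a$ implies ${\uparrow}R_a[x]={\uparrow}R_b[x]$. Valuations map variables to upsets; intuitionistic Kripke clauses and $x\models\phi>\psi$ iff every $y$ with $xR_{V(\phi)}y$ satisfies $\psi$. Sound and complete: the logic's members are exactly the formulas valid on all frames in the class. -}

module Defs where

open import Level using (Level; _⊔_) renaming (suc to lsuc)
open import Data.Nat using (ℕ)
open import Data.Product using (Σ; ∃; ∃-syntax; _×_; _,_; proj₁; proj₂)
open import Data.Empty.Polymorphic using (⊥)
open import Function.Bundles using (_⇔_)
import Data.Sum

infixr 6 _∧'_
infixr 5 _∨'_
infixr 4 _⇒_
infixr 7 _▷_

data Formula : Set where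
  var  : ℕ → Formula
  ⊥'   : Formula
  _∧'_ : Formula → Formula → Formula
  _∨'_ : Formula → Formula → Formula
  _⇒_  : Formula → Formula → Formula
  _▷_  : Formula → Formula → Formula

⊤' : Formula
⊤' = ⊥' ⇒ ⊥'

_⇔'_ : Formula → Formula → Formula
φ ⇔' ψ = (φ ⇒ ψ) ∧' (ψ ⇒ φ)

_[_] : Formula → (ℕ → Formula) → Formula
var n    [ σ ] = σ n
⊥'       [ σ ] = ⊥'
(φ ∧' ψ) [ σ ] = (φ [ σ ]) ∧' (ψ [ σ ])
(φ ∨' ψ) [ σ ] = (φ [ σ ]) ∨' (ψ [ σ ])
(φ ⇒ ψ)  [ σ ] = (φ [ σ ]) ⇒ (ψ [ σ ])
(φ ▷ ψ)  [ σ ] = (φ [ σ ]) ▷ (ψ [ σ ])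

p q r : Formula
p = var 0
q = var 1
r = var 2

data AxiomICB : Formula → Set where
  ipc-K    : AxiomICB (p ⇒ (q ⇒ p))
  ipc-S    : AxiomICB ((p ⇒ (q ⇒ r)) ⇒ ((p ⇒ q) ⇒ (p ⇒ r)))
  ipc-∧e₁  : AxiomICB ((p ∧' q) ⇒ p)
  ipc-∧e₂  : AxiomICB ((p ∧' q) ⇒ q)
  ipc-∧i   : AxiomICB (p ⇒ (q ⇒ (p ∧' q)))
  ipc-∨i₁  : AxiomICB (p ⇒ (p ∨' q))
  ipc-∨i₂  : AxiomICB (q ⇒ (p ∨' q))
  ipc-∨e   : AxiomICB ((p ⇒ r) ⇒ ((q ⇒ r) ⇒ ((p ∨' q) ⇒ r)))
  ipc-efq  : AxiomICB (⊥' ⇒ p)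
  ick-∧    : AxiomICB ((p ▷ (q ∧' r)) ⇔' ((p ▷ q) ∧' (p ▷ r)))
  ick-⊤    : AxiomICB ((p ▷ ⊤') ⇔' ⊤')
  icc-id   : AxiomICB (p ▷ p)
  icc-cut  : AxiomICB (((p ▷ q) ∧' ((p ∧' q) ▷ r)) ⇒ (p ▷ r))
  icc-cm   : AxiomICB (((p ▷ q) ∧' (p ▷ r)) ⇒ ((p ∧' q) ▷ r))
  icb-rec  : AxiomICB (((p ▷ q) ∧' (q ▷ p) ∧' (p ▷ r)) ⇒ (q ▷ r))
  icb-4    : AxiomICB ((p ▷ q) ⇒ (p ▷ (p ▷ q)))

data ICB⊢_ : Formula → Set where
  ax    : ∀ {φ} → AxiomICB φ → ICB⊢ φ
  subst : ∀ {φ} (σ : ℕ → Formula) → ICB⊢ φ → ICB⊢ (φ [ σ ])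
  mp    : ∀ {φ ψ} → ICB⊢ (φ ⇒ ψ) → ICB⊢ φ → ICB⊢ ψ
  congˡ : ∀ {φ ψ} (χ : Formula) → ICB⊢ (φ ⇔' ψ) → ICB⊢ ((φ ▷ χ) ⇔' (ψ ▷ χ))
  congʳ : ∀ {φ ψ} (χ : Formula) → ICB⊢ (φ ⇔' ψ) → ICB⊢ ((χ ▷ φ) ⇔' (χ ▷ ψ))

record Upset {ℓ} (X : Set ℓ) (_≤_ : X → X → Set ℓ) : Set (lsuc ℓ) where
  field
    pred   : X → Set ℓ
    upward : ∀ {x y} → x ≤ y → pred x → pred y
open Upset public

_≐_ : ∀ {ℓ} {X : Set ℓ} → (X → Set ℓ) → (X → Set ℓ) → Set ℓ
A ≐ B = ∀ x → (A x → B x) × (B x → A x)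

_⊆_ : ∀ {ℓ} {X : Set ℓ} → (X → Set ℓ) → (X → Set ℓ) → Set ℓ
A ⊆ B = ∀ x → A x → B x

record Frame (ℓ : Level) : Set (lsuc ℓ) where
  field
    X       : Set ℓ
    point   : X                       -- nonempty
    _≤_     : X → X → Set ℓ
    ≤-refl  : ∀ {x} → x ≤ x
    ≤-trans : ∀ {x y z} → x ≤ y → y ≤ z → x ≤ z
    R       : Upset X _≤_ → X → X → Set ℓ
    -- R is indexed by upsets as *sets*: extensionally equal upsets
    -- have the same relation
    R-ext   : ∀ (a b : Upset X _≤_) → pred a ≐ pred b →
              ∀ x y → (R a x y → R b x y) × (R b x y → R a x y)
    R-mono  : ∀ a {x y z} → x ≤ y → R a y z → ∃[ w ] (R a x w × w ≤ z)

module _ {ℓ} (F : Frame ℓ) where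
  open Frame F

  Rimg : Upset X _≤_ → X → X → Set ℓ
  Rimg a x y = R a x y

  ↑ : (X → Set ℓ) → X → Set ℓ
  ↑ S y = ∃[ s ] (S s × s ≤ y)

  record IsCautious : Set (lsuc ℓ) where
    field
      success : ∀ (a : Upset X _≤_) x → Rimg a x ⊆ pred a
      cm      : ∀ (a b : Upset X _≤_) x → Rimg a x ⊆ pred b → pred b ⊆ pred a →
                ↑ (Rimg a x) ≐ ↑ (Rimg b x)

  record IsICBFrame : Set (lsuc ℓ) where
    field
      cautious : IsCautious
      recip    : ∀ (a b : Upset X _≤_) x → Rimg a x ⊆ pred b → Rimg b x ⊆ pred a →
                 ↑ (Rimg a x) ≐ ↑ (Rimg b x)
      trans4   : ∀ (a : Upset X _≤_) {x y z} → R a x y → R a y z →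
                 ∃[ w ] (R a x w × w ≤ z)

  Valuation : Set (lsuc ℓ)
  Valuation = ℕ → Upset X _≤_

  -- satisfaction, mutually with persistence (so that truth sets are upsets)
  mutual
    sat : Valuation → Formula → X → Set ℓ
    sat V (var n)  x = pred (V n) x
    sat V ⊥'       x = ⊥
    sat V (φ ∧' ψ) x = sat V φ x × sat V ψ x
    sat V (φ ∨' ψ) x = Data.Sum._⊎_ (sat V φ x) (sat V ψ x)
    sat V (φ ⇒ ψ)  x = ∀ y → x ≤ y → sat V φ y → sat V ψ y
    sat V (φ ▷ ψ)  x = ∀ y → R (⟦ V ⟧ φ) x y → sat V ψ y

    ⟦_⟧ : Valuation → Formula → Upset X _≤_
    pred   (⟦ V ⟧ φ) = sat V φ
    upward (⟦ V ⟧ φ) = persist V φ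

    persist : ∀ V φ {x y} → x ≤ y → sat V φ x → sat V φ y
    persist V (var n)  x≤y s = upward (V n) x≤y s
    persist V ⊥'       x≤y ()
    persist V (φ ∧' ψ) x≤y (s , t) = persist V φ x≤y s , persist V ψ x≤y t
    persist V (φ ∨' ψ) x≤y (Data.Sum.inj₁ s) = Data.Sum.inj₁ (persist V φ x≤y s)
    persist V (φ ∨' ψ) x≤y (Data.Sum.inj₂ s) = Data.Sum.inj₂ (persist V ψ x≤y s)
    persist V (φ ⇒ ψ)  x≤y f z y≤z s = f z (≤-trans x≤y y≤z) s
    persist V (φ ▷ ψ)  x≤y f z yRz with R-mono (⟦ V ⟧ φ) x≤y yRz
    ... | w , xRw , w≤z = persist V ψ w≤z (f w xRw)

  Valid : Formula → Set (lsuc ℓ)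
  Valid φ = ∀ (V : Valuation) x → sat V φ x

{-# OPTIONS --safe #-}
module Submission where

-- Completeness is proved constructively by a finite canonical model. Let S be the set of
-- subformulas of φ₀ and L = S ∪ {a ▷ b : a, b ∈ S}. Starting from all subsets of L, worlds that
-- fail a local condition, or lack a witness among the surviving worlds, are eliminated; each
-- elimination comes with a derivation of the sequent W ⊢ L ∖ W. When nothing more can be
-- eliminated, either φ₀ is derivable or some survivor omits φ₀, and the survivors form a
-- model. Its relations are first defined for the truth sets of formulas in S and then extended
-- to arbitrary upsets u: if Acc W c ⊆ u ⊆ ĉ for some c ∈ S then u gets the relation of c, and
-- otherwise it selects all of u. Reciprocity makes this independent of c.

open import Defs
open import Level using (Level; Lift; lift; lower)
open import Function.Bundles using (_⇔_; mk⇔)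
open import Function.Base using (_∘_)
open import Data.Nat using (ℕ; zero; suc)
import Data.Nat.Properties as ℕ
open import Data.Empty using (⊥-elim)
open import Data.Unit using (⊤; tt)
open import Data.Product using (∃-syntax; _×_; _,_; proj₁; proj₂; uncurry)
open import Data.Sum using (_⊎_; inj₁; inj₂; [_,_]; swap)
open import Data.List using (List; []; _∷_; _++_; map; filter; length; cartesianProduct; cartesianProductWith)
open import Data.List.Membership.Propositional using (_∈_; _∉_)
open import Data.List.Membership.Propositional.Properties
  using (∈-++⁺ˡ; ∈-++⁺ʳ; ∈-++⁻; ∈-map⁺; ∈-map⁻; ∈-filter⁺; ∈-filter⁻;
         ∈-cartesianProduct⁺; ∈-cartesianProductWith⁺)
import Data.List.Membership.DecPropositional as DecMembership
open import Data.List.Relation.Unary.Any using (Any; here; there)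
open import Data.List.Relation.Unary.All using (All; []; _∷_)
import Data.List.Relation.Unary.All as All
open import Relation.Nullary using (¬_; Dec; yes; no; contradiction)
open import Relation.Nullary.Decidable using (map′; _×-dec_; decidable-stable)
open import Relation.Binary.Definitions using (DecidableEquality)
open import Relation.Binary.PropositionalEquality using (_≡_; refl; sym; trans; cong; cong₂)

-- Soundness

module Soundness {ℓ} (F : Frame ℓ) where
  open Frame F

  sat-subst : ∀ (V : Valuation F) σ φ x →
    (sat F V (φ [ σ ]) x → sat F (⟦_⟧ F V ∘ σ) φ x) ×
    (sat F (⟦_⟧ F V ∘ σ) φ x → sat F V (φ [ σ ]) x)
  sat-subst V σ (var n) x = (λ s → s) , (λ s → s)
  sat-subst V σ ⊥' x = (λ s → s) , (λ s → s)
  sat-subst V σ (φ ∧' ψ) x =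
    (λ (s , t) → proj₁ (sat-subst V σ φ x) s , proj₁ (sat-subst V σ ψ x) t) ,
    (λ (s , t) → proj₂ (sat-subst V σ φ x) s , proj₂ (sat-subst V σ ψ x) t)
  sat-subst V σ (φ ∨' ψ) x =
    [ inj₁ ∘ proj₁ (sat-subst V σ φ x) , inj₂ ∘ proj₁ (sat-subst V σ ψ x) ] ,
    [ inj₁ ∘ proj₂ (sat-subst V σ φ x) , inj₂ ∘ proj₂ (sat-subst V σ ψ x) ]
  sat-subst V σ (φ ⇒ ψ) x =
    (λ s y x≤y t → proj₁ (sat-subst V σ ψ y) (s y x≤y (proj₂ (sat-subst V σ φ y) t))) ,
    (λ s y x≤y t → proj₂ (sat-subst V σ ψ y) (s y x≤y (proj₁ (sat-subst V σ φ y) t)))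
  sat-subst V σ (φ ▷ ψ) x =
    (λ s y xRy → proj₁ (sat-subst V σ ψ y) (s y (proj₂ (same x y) xRy))) ,
    (λ s y xRy → proj₂ (sat-subst V σ ψ y) (s y (proj₁ (same x y) xRy)))
    -- By induction the two truth sets agree only pointwise, which is what `R-ext` asks for.
    where same = R-ext (⟦_⟧ F V (φ [ σ ])) (⟦_⟧ F (⟦_⟧ F V ∘ σ) φ) (sat-subst V σ φ)

  module _ (icb : IsICBFrame F) where
    open IsICBFrame icb
    open IsCautious cautious

    -- The frame conditions compare only upward closures of images; persistence of `ψ` makes that
    -- enough.
    ▷-transfer : ∀ (V : Valuation F) (a b : Upset X _≤_) ψ {x} →
      (∀ y → ↑ F (Rimg F b x) y → ↑ F (Rimg F a x) y) →
      (∀ y → R a x y → sat F V ψ y) → ∀ y → R b x y → sat F V ψ y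
    ▷-transfer V a b ψ sub s y bRy with sub y (y , bRy , ≤-refl)
    ... | z , aRz , z≤y = persist F V ψ z≤y (s z aRz)

    axiom-valid : ∀ {φ} → AxiomICB φ → Valid F φ
    axiom-valid ipc-K V x y _ s z y≤z _ = upward (V 0) y≤z s
    axiom-valid ipc-S V x y _ s z y≤z t w z≤w u =
      s w (≤-trans y≤z z≤w) u w ≤-refl (t w z≤w u)
    axiom-valid ipc-∧e₁ V x y _ (s , t) = s
    axiom-valid ipc-∧e₂ V x y _ (s , t) = t
    axiom-valid ipc-∧i V x y _ s z y≤z t = upward (V 0) y≤z s , t
    axiom-valid ipc-∨i₁ V x y _ s = inj₁ s
    axiom-valid ipc-∨i₂ V x y _ s = inj₂ s
    axiom-valid ipc-∨e V x y _ s z y≤z t w z≤w =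
      [ s w (≤-trans y≤z z≤w) , t w z≤w ]
    axiom-valid ipc-efq V x y _ ()
    axiom-valid ick-∧ V x =
      (λ y _ s → (λ z yRz → proj₁ (s z yRz)) , (λ z yRz → proj₂ (s z yRz))) ,
      (λ y _ (s , t) z yRz → s z yRz , t z yRz)
    axiom-valid ick-⊤ V x = (λ _ _ _ _ _ s → s) , (λ _ _ _ _ _ _ _ s → s)
    axiom-valid icc-id V x y xRy = success (⟦_⟧ F V p) x y xRy
    axiom-valid icc-cut V x y _ (s , t) =
      -- The image of `p` lies in `p ∧' q`, by success and `s`, and `p ∧' q` lies in `p`, so `cm`
      -- identifies the closures.
      ▷-transfer V pq (⟦_⟧ F V p) r
        (λ z → proj₁ (cm (⟦_⟧ F V p) pq y
          (λ w yRw → success (⟦_⟧ F V p) y w yRw , s w yRw) (λ _ → proj₁) z)) t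
      where pq = ⟦_⟧ F V (p ∧' q)
    axiom-valid icc-cm V x y _ (s , t) =
      ▷-transfer V (⟦_⟧ F V p) pq r
        (λ z → proj₂ (cm (⟦_⟧ F V p) pq y
          (λ w yRw → success (⟦_⟧ F V p) y w yRw , s w yRw) (λ _ → proj₁) z)) t
      where pq = ⟦_⟧ F V (p ∧' q)
    axiom-valid icb-rec V x y _ (s , t , u) =
      ▷-transfer V (⟦_⟧ F V p) (⟦_⟧ F V q) r
        (λ z → proj₂ (recip (⟦_⟧ F V p) (⟦_⟧ F V q) y s t z)) u
    axiom-valid icb-4 V x y _ s z yRz w zRw with trans4 (⟦_⟧ F V p) yRz zRw
    ... | v , yRv , v≤w = upward (V 1) v≤w (s v yRv)

    soundness : ∀ {φ} → ICB⊢ φ → Valid F φ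
    soundness (ax a) = axiom-valid a
    soundness (subst {φ} σ d) V x =
      proj₂ (sat-subst V σ φ x) (soundness d (⟦_⟧ F V ∘ σ) x)
    soundness (mp d e) V x = soundness d V x x ≤-refl (soundness e V x)
    soundness (congˡ {φ} {ψ} χ d) V x =
      (λ y _ s z yRz → s z (proj₂ (same y z) yRz)) ,
      (λ y _ s z yRz → s z (proj₁ (same y z) yRz))
      where
      same = R-ext (⟦_⟧ F V φ) (⟦_⟧ F V ψ)
        (λ y → proj₁ (soundness d V y) y ≤-refl , proj₂ (soundness d V y) y ≤-refl)
    soundness (congʳ χ d) V x =
      (λ y _ s z yRz → proj₁ (soundness d V z) z ≤-refl (s z yRz)) ,
      (λ y _ s z yRz → proj₂ (soundness d V z) z ≤-refl (s z yRz))

-- Derivations from hypotheses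

infix 2 _⊢_
infixl 8 _·_

-- Substitution and congruence are confined to `thm`; only modus ponens acts on hypotheses, so the
-- deduction theorem holds.
data _⊢_ (Γ : List Formula) : Formula → Set where
  hyp : ∀ {φ} → φ ∈ Γ → Γ ⊢ φ
  thm : ∀ {φ} → ICB⊢ φ → Γ ⊢ φ
  _·_ : ∀ {φ ψ} → Γ ⊢ φ ⇒ ψ → Γ ⊢ φ → Γ ⊢ ψ

instantiate : Formula → Formula → Formula → ℕ → Formula
instantiate a b c 0 = a
instantiate a b c 1 = b
instantiate a b c (suc (suc _)) = c

axiom : ∀ {Γ φ} → AxiomICB φ → ∀ a b c → Γ ⊢ φ [ instantiate a b c ]
axiom α a b c = thm (subst (instantiate a b c) (ax α))

deduction : ∀ {Γ φ ψ} → φ ∷ Γ ⊢ ψ → Γ ⊢ φ ⇒ ψ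
deduction {φ = φ} (hyp (here refl)) =
  axiom ipc-S φ (φ ⇒ φ) φ · axiom ipc-K φ (φ ⇒ φ) φ · axiom ipc-K φ φ φ
deduction {φ = φ} (hyp {ψ} (there m)) = axiom ipc-K ψ φ φ · hyp m
deduction {φ = φ} (thm {ψ} d) = axiom ipc-K ψ φ φ · thm d
deduction {φ = φ} (_·_ {χ} {ψ} d e) = axiom ipc-S φ χ ψ · deduction d · deduction e

discharge : ∀ {φ} → [] ⊢ φ → ICB⊢ φ
discharge (thm d) = d
discharge (d · e) = mp (discharge d) (discharge e)

cut : ∀ {Γ Δ φ} → (∀ {χ} → χ ∈ Δ → Γ ⊢ χ) → Δ ⊢ φ → Γ ⊢ φ
cut s (hyp m) = s m
cut s (thm d) = thm d
cut s (d · e) = cut s d · cut s e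

h₀ : ∀ {a Γ} → a ∷ Γ ⊢ a
h₀ = hyp (here refl)

h₁ : ∀ {a b Γ} → a ∷ b ∷ Γ ⊢ b
h₁ = hyp (there (here refl))

h₂ : ∀ {a b c Γ} → a ∷ b ∷ c ∷ Γ ⊢ c
h₂ = hyp (there (there (here refl)))

∧-intro : ∀ {Γ a b} → Γ ⊢ a → Γ ⊢ b → Γ ⊢ a ∧' b
∧-intro {a = a} {b} d e = axiom ipc-∧i a b b · d · e

∧-elimˡ : ∀ {Γ a b} → Γ ⊢ a ∧' b → Γ ⊢ a
∧-elimˡ {a = a} {b} d = axiom ipc-∧e₁ a b b · d

∧-elimʳ : ∀ {Γ a b} → Γ ⊢ a ∧' b → Γ ⊢ b
∧-elimʳ {a = a} {b} d = axiom ipc-∧e₂ a b b · d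

▷-intro-∧ : ∀ {Γ a b c} → Γ ⊢ a ▷ b → Γ ⊢ a ▷ c → Γ ⊢ a ▷ (b ∧' c)
▷-intro-∧ {a = a} {b} {c} d e = ∧-elimʳ (axiom ick-∧ a b c) · ∧-intro d e

-- Given `b ⊢ c`, `b` is provably equivalent to `b ∧' c`; congruence and distribution over `∧'` do
-- the rest.
▷-mono : ∀ {Γ a b c} → b ∷ [] ⊢ c → Γ ⊢ a ▷ b → Γ ⊢ a ▷ c
▷-mono {a = a} {b} {c} d e =
  ∧-elimʳ (∧-elimˡ (axiom ick-∧ a b c) · (∧-elimˡ (thm (congʳ a b⇔b∧c)) · e))
  where
  b⇔b∧c : ICB⊢ (b ⇔' (b ∧' c))
  b⇔b∧c = discharge (∧-intro (deduction (∧-intro h₀ d)) (deduction (∧-elimˡ h₀)))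

-- Theorems pass under the conditional by `ick-⊤`, and modus ponens by distribution over `∧'`.
▷-lift : ∀ {Γ Δ a b} → (∀ {χ} → χ ∈ Δ → Γ ⊢ a ▷ χ) → Δ ⊢ b → Γ ⊢ a ▷ b
▷-lift s (hyp m) = s m
▷-lift {a = a} s (thm d) =
  ▷-mono (thm d) (∧-elimʳ (axiom ick-⊤ a a a) · deduction h₀)
▷-lift s (d · e) =
  ▷-mono (∧-elimˡ h₀ · ∧-elimʳ h₀) (▷-intro-∧ (▷-lift s d) (▷-lift s e))

▷-refl : ∀ {Γ} a → Γ ⊢ a ▷ a
▷-refl a = axiom icc-id a a a

▷-recip : ∀ {Γ a b c} → Γ ⊢ a ▷ b → Γ ⊢ b ▷ a → Γ ⊢ a ▷ c → Γ ⊢ b ▷ c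
▷-recip {a = a} {b} {c} d e f = axiom icb-rec a b c · ∧-intro d (∧-intro e f)

▷-iterate : ∀ {Γ a b} → Γ ⊢ a ▷ b → Γ ⊢ a ▷ (a ▷ b)
▷-iterate {a = a} {b} d = axiom icb-4 a b b · d

-- Decidable equality of formulas

-- Formulas are compared through binary trees, which have far fewer constructor clashes.
data Tree : Set where
  leaf : ℕ → Tree
  node : ℕ → Tree → Tree → Tree

_≟ᵗ_ : DecidableEquality Tree
leaf m ≟ᵗ leaf n = map′ (cong leaf) (λ { refl → refl }) (m ℕ.≟ n)
leaf _ ≟ᵗ node _ _ _ = no λ ()
node _ _ _ ≟ᵗ leaf _ = no λ ()
node m s t ≟ᵗ node n u v =
  map′ (λ { (refl , refl , refl) → refl }) (λ { refl → refl , refl , refl })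
       (m ℕ.≟ n ×-dec s ≟ᵗ u ×-dec t ≟ᵗ v)

encode : Formula → Tree
encode (var n)  = leaf (suc n)
encode ⊥'       = leaf 0
encode (φ ∧' ψ) = node 0 (encode φ) (encode ψ)
encode (φ ∨' ψ) = node 1 (encode φ) (encode ψ)
encode (φ ⇒ ψ)  = node 2 (encode φ) (encode ψ)
encode (φ ▷ ψ)  = node 3 (encode φ) (encode ψ)

decode : Tree → Formula
decode (leaf 0)       = ⊥'
decode (leaf (suc n)) = var n
decode (node 0 s t)   = decode s ∧' decode t
decode (node 1 s t)   = decode s ∨' decode t
decode (node 2 s t)   = decode s ⇒ decode t
-- Only tag 3 comes from `encode`; larger tags keep `decode` total.
decode (node (suc (suc (suc _))) s t) = decode s ▷ decode t

decode-encode : ∀ φ → decode (encode φ) ≡ φ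
decode-encode (var n)  = refl
decode-encode ⊥'       = refl
decode-encode (φ ∧' ψ) = cong₂ _∧'_ (decode-encode φ) (decode-encode ψ)
decode-encode (φ ∨' ψ) = cong₂ _∨'_ (decode-encode φ) (decode-encode ψ)
decode-encode (φ ⇒ ψ)  = cong₂ _⇒_ (decode-encode φ) (decode-encode ψ)
decode-encode (φ ▷ ψ)  = cong₂ _▷_ (decode-encode φ) (decode-encode ψ)

_≟_ : DecidableEquality Formula
φ ≟ ψ = map′
  (λ e → trans (sym (decode-encode φ)) (trans (cong decode e) (decode-encode ψ)))
  (cong encode) (encode φ ≟ᵗ encode ψ)

open DecMembership _≟_ using (_∈?_)

-- Subformulas and sublists

sub : Formula → List Formula
sub (var n)  = var n ∷ []
sub ⊥'       = ⊥' ∷ []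
sub (φ ∧' ψ) = (φ ∧' ψ) ∷ sub φ ++ sub ψ
sub (φ ∨' ψ) = (φ ∨' ψ) ∷ sub φ ++ sub ψ
sub (φ ⇒ ψ)  = (φ ⇒ ψ) ∷ sub φ ++ sub ψ
sub (φ ▷ ψ)  = (φ ▷ ψ) ∷ sub φ ++ sub ψ

sub-refl : ∀ φ → φ ∈ sub φ
sub-refl (var n)  = here refl
sub-refl ⊥'       = here refl
sub-refl (φ ∧' ψ) = here refl
sub-refl (φ ∨' ψ) = here refl
sub-refl (φ ⇒ ψ)  = here refl
sub-refl (φ ▷ ψ)  = here refl

mutual
  sub-trans : ∀ {φ ψ χ} → ψ ∈ sub φ → χ ∈ sub ψ → χ ∈ sub φ
  sub-trans {var n} (here refl) m = m
  sub-trans {⊥'}    (here refl) m = m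
  sub-trans {φ ∧' ψ} (here refl) m = m
  sub-trans {φ ∧' ψ} (there l)   m = there (sub-trans-++ φ ψ l m)
  sub-trans {φ ∨' ψ} (here refl) m = m
  sub-trans {φ ∨' ψ} (there l)   m = there (sub-trans-++ φ ψ l m)
  sub-trans {φ ⇒ ψ} (here refl) m = m
  sub-trans {φ ⇒ ψ} (there l)   m = there (sub-trans-++ φ ψ l m)
  sub-trans {φ ▷ ψ} (here refl) m = m
  sub-trans {φ ▷ ψ} (there l)   m = there (sub-trans-++ φ ψ l m)

  sub-trans-++ : ∀ φ₁ φ₂ {ψ χ} → ψ ∈ sub φ₁ ++ sub φ₂ → χ ∈ sub ψ → χ ∈ sub φ₁ ++ sub φ₂
  sub-trans-++ φ₁ φ₂ l m with ∈-++⁻ (sub φ₁) l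
  ... | inj₁ l₁ = ∈-++⁺ˡ (sub-trans l₁ m)
  ... | inj₂ l₂ = ∈-++⁺ʳ (sub φ₁) (sub-trans l₂ m)

sublists : ∀ {A : Set} → List A → List (List A)
sublists []       = [] ∷ []
sublists (x ∷ xs) = map (x ∷_) (sublists xs) ++ sublists xs

filter∈sublists : ∀ {A : Set} {P : A → Set} (P? : ∀ x → Dec (P x)) xs →
  filter P? xs ∈ sublists xs
filter∈sublists P? [] = here refl
filter∈sublists P? (x ∷ xs) with P? x
... | yes _ = ∈-++⁺ˡ (∈-map⁺ (x ∷_) (filter∈sublists P? xs))
... | no  _ = ∈-++⁺ʳ (map (x ∷_) (sublists xs)) (filter∈sublists P? xs)

-- Lets the do-blocks below stop at the first refutation.
_>>=_ : {A B C : Set} → A ⊎ B → (B → A ⊎ C) → A ⊎ C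
m >>= f = [ inj₁ , f ] m

all⊎ : ∀ {A B : Set} {P : A → Set} xs → (∀ {x} → x ∈ xs → B ⊎ P x) →
  B ⊎ (∀ {x} → x ∈ xs → P x)
all⊎ [] f = inj₂ λ ()
all⊎ (x ∷ xs) f = do
  px  ← f (here refl)
  pxs ← all⊎ xs (f ∘ there)
  inj₂ λ { (here refl) → px ; (there m) → pxs m }

discard : ∀ {A : Set} {P : A → Set} {xs} → Any P xs →
  ∃[ ys ] (length xs ≡ suc (length ys) × (∀ {x} → x ∈ xs → x ∈ ys ⊎ P x))
discard {xs = x ∷ xs} (here px) =
  xs , refl , λ { (here refl) → inj₂ px ; (there m) → inj₁ m }
discard {xs = x ∷ xs} (there i) with discard i
... | ys , eq , f = x ∷ ys , cong suc eq ,
  λ { (here refl) → inj₁ (here refl) ; (there m) → [ inj₁ ∘ there , inj₂ ] (f m) }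

-- Elimination of refutable worlds

module Elimination (φ₀ : Formula) where

  S : List Formula
  S = sub φ₀

  -- Equivalence of antecedents and the demands of accessibility are conditionals between arbitrary
  -- members of `S`, so worlds have to decide these too.
  L : List Formula
  L = S ++ cartesianProductWith _▷_ S S

  S⊆L : ∀ {a} → a ∈ S → a ∈ L
  S⊆L = ∈-++⁺ˡ

  ▷∈L : ∀ {a b} → a ∈ S → b ∈ S → (a ▷ b) ∈ L
  ▷∈L a∈ b∈ = ∈-++⁺ʳ S (∈-cartesianProductWith⁺ _▷_ a∈ b∈)

  left∈S : ∀ {χ} a b → (∀ {ψ} → ψ ∈ sub a ++ sub b → ψ ∈ sub χ) → χ ∈ S → a ∈ S
  left∈S a b f m = sub-trans m (f (∈-++⁺ˡ (sub-refl a)))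

  right∈S : ∀ {χ} a b → (∀ {ψ} → ψ ∈ sub a ++ sub b → ψ ∈ sub χ) → χ ∈ S → b ∈ S
  right∈S a b f m = sub-trans m (f (∈-++⁺ʳ (sub a) (sub-refl b)))

  World : Set
  World = List Formula

  infix 4 _≼_
  -- Restricting to `L` allows any list of hypotheses on the left, as in `lindenbaum`.
  _≼_ : World → World → Set
  W ≼ V = ∀ {χ} → χ ∈ L → χ ∈ W → χ ∈ V

  record Equiv (W : World) (a d : Formula) : Set where
    constructor equiv
    field
      to   : (a ▷ d) ∈ W
      from : (d ▷ a) ∈ W

  -- Canonical accessibility. Quantifying over all d equivalent to a makes it depend on the
  -- W-equivalence class of a only; keeping d ▷ c in V makes it transitive.
  Acc : World → Formula → World → Set
  Acc W a V = ∀ {d c} → d ∈ S → c ∈ S → Equiv W a d → (d ▷ c) ∈ W → c ∈ V × (d ▷ c) ∈ V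

  -- The sequent with W on the left and L ∖ W on the right is derivable.
  Refuted : World → Set
  Refuted W = ∀ {Γ δ} → (∀ {χ} → χ ∈ W → Γ ⊢ χ) →
    (∀ {χ} → χ ∈ L → χ ∉ W → Γ ⊢ χ ⇒ δ) → Γ ⊢ δ

  refute : ∀ {W χ} → χ ∈ L → χ ∉ W → W ⊢ χ → Refuted W
  refute χ∈L χ∉W d s t = t χ∈L χ∉W · cut s d

  -- Membership is decidable, and a failure of closure puts the premises in `W` and the conclusion
  -- in the rest of `L`.
  rule : ∀ W Δ {χ} → χ ∈ L → Δ ⊢ χ → Refuted W ⊎ (All (_∈ W) Δ → χ ∈ W)
  rule W Δ {χ} χ∈L d with χ ∈? W | All.all? (_∈? W) Δ
  ... | yes m | _     = inj₂ λ _ → m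
  ... | no  _ | no ¬a = inj₂ λ a → ⊥-elim (¬a a)
  ... | no ¬m | yes a = inj₁ (refute χ∈L ¬m (cut (hyp ∘ All.lookup a) d))

  Local : List World → World → Formula → Set
  Local A W (var n)  = ⊤
  Local A W ⊥'       = ⊥' ∉ W
  Local A W (a ∧' b) = ((a ∧' b) ∈ W → a ∈ W × b ∈ W) × (a ∈ W × b ∈ W → (a ∧' b) ∈ W)
  Local A W (a ∨' b) = ((a ∨' b) ∈ W → a ∈ W ⊎ b ∈ W) × (a ∈ W ⊎ b ∈ W → (a ∨' b) ∈ W)
  Local A W (a ⇒ b)  = ((a ⇒ b) ∈ W → a ∈ W → b ∈ W) ×
    ((a ⇒ b) ∉ W → ∃[ V ] (V ∈ A × W ≼ V × a ∈ V × b ∉ V))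
  Local A W (a ▷ b)  = ⊤

  record Good (A : List World) (W : World) : Set where
    field
      local  : ∀ {a} → a ∈ S → Local A W a
      ▷-id   : ∀ {a} → a ∈ S → (a ▷ a) ∈ W
      ▷-rec  : ∀ {a} → a ∈ S → ∀ {b} → b ∈ S → ∀ {c} → c ∈ S →
               (a ▷ b) ∈ W → (b ▷ a) ∈ W → (a ▷ c) ∈ W → (b ▷ c) ∈ W
      refuse : ∀ {a} → a ∈ S → ∀ {b} → b ∈ S → (a ▷ b) ∉ W →
               ∃[ V ] (V ∈ A × Acc W a V × b ∉ V)

  -- The invariant of the elimination: only refuted subsets have been lost.
  Covers : List World → Set
  Covers A = ∀ {W} → W ∈ sublists L → W ∈ A ⊎ Refuted W

  module _ {A : List World} (covers : Covers A) where

    -- The pending formulas `ps` are decided in turn. Each is first added to `T`; if that ends in a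
    -- derivation of `δ`, it is rejected, and the deduction theorem records that it implies `δ`. At
    -- the end the part of `T` in `L` is a world of `A` or refuted, and a refutation combines with
    -- the recorded implications to derive `δ`.
    lindenbaum′ : ∀ δ ps T → (∀ {χ} → χ ∈ L → χ ∈ ps ⊎ χ ∈ T ⊎ (T ⊢ χ ⇒ δ)) →
      (T ⊢ δ) ⊎ ∃[ V ] (V ∈ A × T ≼ V × δ ∉ V)
    lindenbaum′ δ [] T decided with δ ∈? T | covers (filter∈sublists (_∈? T) L)
    ... | yes m | _ = inj₁ (hyp m)
    ... | no ¬m | inj₁ V∈A =
      inj₂ (_ , V∈A , ∈-filter⁺ (_∈? T) , ¬m ∘ proj₂ ∘ ∈-filter⁻ (_∈? T) {xs = L})
    ... | no ¬m | inj₂ refuted =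
      inj₁ (refuted (hyp ∘ proj₂ ∘ ∈-filter⁻ (_∈? T) {xs = L}) outside)
      where
      outside : ∀ {χ} → χ ∈ L → χ ∉ filter (_∈? T) L → T ⊢ χ ⇒ δ
      outside χ∈L χ∉V with decided χ∈L
      ... | inj₂ (inj₁ χ∈T) = ⊥-elim (χ∉V (∈-filter⁺ (_∈? T) χ∈L χ∈T))
      ... | inj₂ (inj₂ d)   = d
    lindenbaum′ δ (π ∷ ps) T decided with lindenbaum′ δ ps (π ∷ T) decided⁺
      where
      decided⁺ : ∀ {χ} → χ ∈ L → χ ∈ ps ⊎ χ ∈ (π ∷ T) ⊎ (π ∷ T ⊢ χ ⇒ δ)
      decided⁺ χ∈L with decided χ∈L
      ... | inj₁ (here refl) = inj₂ (inj₁ (here refl))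
      ... | inj₁ (there m)   = inj₁ m
      ... | inj₂ (inj₁ m)    = inj₂ (inj₁ (there m))
      ... | inj₂ (inj₂ d)    = inj₂ (inj₂ (cut (hyp ∘ there) d))
    ... | inj₂ (V , V∈A , T≼V , δ∉V) = inj₂ (V , V∈A , (λ l m → T≼V l (there m)) , δ∉V)
    ... | inj₁ d = lindenbaum′ δ ps T decided⁻
      where
      decided⁻ : ∀ {χ} → χ ∈ L → χ ∈ ps ⊎ χ ∈ T ⊎ (T ⊢ χ ⇒ δ)
      decided⁻ χ∈L with decided χ∈L
      ... | inj₁ (here refl) = inj₂ (inj₂ (deduction d))
      ... | inj₁ (there m)   = inj₁ m
      ... | inj₂ e           = inj₂ e

    lindenbaum : ∀ Γ δ → (Γ ⊢ δ) ⊎ ∃[ V ] (V ∈ A × Γ ≼ V × δ ∉ V)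
    lindenbaum Γ δ = lindenbaum′ δ L Γ inj₁

    check-local : ∀ W {a} → a ∈ S → Refuted W ⊎ Local A W a
    check-local W {var n} a∈S = inj₂ tt
    check-local W {⊥'} a∈S with ⊥' ∈? W
    ... | yes m = inj₁ λ {_} {δ} s _ → axiom ipc-efq δ δ δ · s m
    ... | no ¬m = inj₂ ¬m
    check-local W {a ∧' b} m = do
      e₁ ← rule W ((a ∧' b) ∷ []) (S⊆L (left∈S a b there m)) (∧-elimˡ h₀)
      e₂ ← rule W ((a ∧' b) ∷ []) (S⊆L (right∈S a b there m)) (∧-elimʳ h₀)
      i  ← rule W (a ∷ b ∷ []) (S⊆L m) (∧-intro h₀ h₁)
      inj₂ ((λ s → e₁ (s ∷ []) , e₂ (s ∷ [])) , λ (s , t) → i (s ∷ t ∷ []))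
    check-local W {a ∨' b} m = do
      i₁ ← rule W (a ∷ []) (S⊆L m) (axiom ipc-∨i₁ a b b · h₀)
      i₂ ← rule W (b ∷ []) (S⊆L m) (axiom ipc-∨i₂ a b b · h₀)
      e  ← split
      inj₂ (e , [ (λ s → i₁ (s ∷ [])) , (λ s → i₂ (s ∷ [])) ])
      where
      split : Refuted W ⊎ ((a ∨' b) ∈ W → a ∈ W ⊎ b ∈ W)
      split with (a ∨' b) ∈? W | a ∈? W | b ∈? W
      ... | no ¬s | _     | _     = inj₂ λ s → ⊥-elim (¬s s)
      ... | yes _ | yes s | _     = inj₂ λ _ → inj₁ s
      ... | yes _ | no _  | yes s = inj₂ λ _ → inj₂ s
      -- Both disjuncts lie outside `W`, so `g` makes each imply the arbitrary goal `δ`.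
      ... | yes s | no ¬t | no ¬u = inj₁ λ {_} {δ} f g →
        axiom ipc-∨e a b δ · g (S⊆L (left∈S a b there m)) ¬t
                           · g (S⊆L (right∈S a b there m)) ¬u · f s
    check-local W {a ⇒ b} m = do
      e ← rule W ((a ⇒ b) ∷ a ∷ []) (S⊆L (right∈S a b there m)) (h₀ · h₁)
      i ← witness
      inj₂ ((λ s t → e (s ∷ t ∷ [])) , i)
      where
      witness : Refuted W ⊎ ((a ⇒ b) ∉ W → ∃[ V ] (V ∈ A × W ≼ V × a ∈ V × b ∉ V))
      witness with (a ⇒ b) ∈? W | lindenbaum (a ∷ W) b
      ... | yes s | _      = inj₂ λ ¬s → ⊥-elim (¬s s)
      ... | no ¬s | inj₁ d = inj₁ (refute (S⊆L m) ¬s (deduction d))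
      ... | no _  | inj₂ (V , V∈A , aW≼V , b∉V) = inj₂ λ _ →
        V , V∈A , (λ l s → aW≼V l (there s)) , aW≼V (S⊆L (left∈S a b there m)) (here refl) , b∉V
    check-local W {a ▷ b} m = inj₂ tt

    -- `Θ` lists everything `Acc W a V` demands of `V`. By reciprocity and `icb-4`, `W` derives
    -- `a ▷ χ` for each `χ` in `Θ`; hence `Θ ⊢ b` would give `W ⊢ a ▷ b`, and otherwise a world
    -- extending `Θ` omits `b`.
    check-refuse : ∀ W {a} → a ∈ S → ∀ {b} → b ∈ S →
      Refuted W ⊎ ((a ▷ b) ∉ W → ∃[ V ] (V ∈ A × Acc W a V × b ∉ V))
    check-refuse W {a} a∈S {b} b∈S = result
      where
      Demand : Formula × Formula → Set
      Demand (d , c) = ((a ▷ d) ∈ W × (d ▷ a) ∈ W) × (d ▷ c) ∈ W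

      demand? : ∀ dc → Dec (Demand dc)
      demand? (d , c) = (((a ▷ d) ∈? W) ×-dec ((d ▷ a) ∈? W)) ×-dec ((d ▷ c) ∈? W)

      demands : List (Formula × Formula)
      demands = filter demand? (cartesianProduct S S)

      Θ : List Formula
      Θ = map proj₂ demands ++ map (uncurry _▷_) demands

      ⊢▷demand : ∀ {χ} → χ ∈ Θ → W ⊢ a ▷ χ
      ⊢▷demand χ∈Θ with ∈-++⁻ (map proj₂ demands) χ∈Θ
      ... | inj₁ m with ∈-map⁻ proj₂ m
      ...   | (d , c) , n , refl with ∈-filter⁻ demand? {xs = cartesianProduct S S} n
      ...     | _ , (ad , da) , dc = ▷-recip (hyp da) (hyp ad) (hyp dc)
      ⊢▷demand χ∈Θ | inj₂ m with ∈-map⁻ (uncurry _▷_) m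
      ...   | (d , c) , n , refl with ∈-filter⁻ demand? {xs = cartesianProduct S S} n
      ...     | _ , (ad , da) , dc = ▷-recip (hyp da) (hyp ad) (▷-iterate (hyp dc))

      result : Refuted W ⊎ ((a ▷ b) ∉ W → ∃[ V ] (V ∈ A × Acc W a V × b ∉ V))
      result with (a ▷ b) ∈? W | lindenbaum Θ b
      ... | yes s | _      = inj₂ λ ¬s → ⊥-elim (¬s s)
      ... | no ¬s | inj₁ d = inj₁ (refute (▷∈L a∈S b∈S) ¬s (▷-lift ⊢▷demand d))
      ... | no _  | inj₂ (V , V∈A , Θ≼V , b∉V) = inj₂ λ _ → V , V∈A , acc , b∉V
        where
        acc : Acc W a V
        acc d∈S c∈S (equiv ad da) dc =
          Θ≼V (S⊆L c∈S) (∈-++⁺ˡ (∈-map⁺ proj₂ m)) ,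
          Θ≼V (▷∈L d∈S c∈S) (∈-++⁺ʳ (map proj₂ demands) (∈-map⁺ (uncurry _▷_) m))
          where m = ∈-filter⁺ demand? (∈-cartesianProduct⁺ d∈S c∈S) ((ad , da) , dc)

    examine : ∀ W → Refuted W ⊎ Good A W
    examine W = do
      loc ← all⊎ S (check-local W)
      idn ← all⊎ S λ {a} a∈ → rule W [] (▷∈L a∈ a∈) (▷-refl a)
      rec ← all⊎ S λ {a} a∈ → all⊎ S λ {b} b∈ → all⊎ S λ {c} c∈ →
              rule W ((a ▷ b) ∷ (b ▷ a) ∷ (a ▷ c) ∷ []) (▷∈L b∈ c∈) (▷-recip h₀ h₁ h₂)
      ref ← all⊎ S λ a∈ → all⊎ S (check-refuse W a∈)
      inj₂ record
        { local = loc ; ▷-id = λ a∈ → idn a∈ [] ; refuse = ref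
        ; ▷-rec = λ a∈ b∈ c∈ s t u → rec a∈ b∈ c∈ (s ∷ t ∷ u ∷ []) }

  -- The length `n` drops in each round. Refutations do not mention the list, so they remain valid
  -- as it shrinks.
  eliminate : ∀ n A → length A ≡ n → Covers A →
    ∃[ B ] (Covers B × (∀ {W} → W ∈ B → Good B W))
  eliminate n A len covers with All.decide {P = Good A} {Q = Refuted} (swap ∘ examine covers) A
  ... | inj₁ good = A , covers , All.lookup good
  ... | inj₂ bad with discard bad
  eliminate zero A len covers | inj₂ bad | B , eq , split = contradiction (trans (sym eq) len) λ ()
  eliminate (suc n) A len covers | inj₂ bad | B , eq , split =
    eliminate n B (ℕ.suc-injective (trans (sym eq) len)) (λ m → [ split , inj₂ ] (covers m))

  survivors : ∃[ B ] (Covers B × (∀ {W} → W ∈ B → Good B W))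
  survivors = eliminate _ (sublists L) refl inj₁

-- The finite canonical model

module Canonical (φ₀ : Formula) (ℓ : Level) where
  open Elimination φ₀

  A : List World
  A = proj₁ survivors

  covers : Covers A
  covers = proj₁ (proj₂ survivors)

  Point : Set
  Point = ∃[ W ] (W ∈ A)

  module Pt (x : Point) = Good (proj₂ (proj₂ survivors) (proj₂ x))

  Accˣ : Point → Formula → Point → Set
  Accˣ (W , _) a (V , _) = Acc W a V

  _∋_ : Point → Formula → Set
  (W , _) ∋ a = a ∈ W

  ▷-complete : ∀ x {a b} → a ∈ S → b ∈ S → (∀ y → Accˣ x a y → y ∋ b) → x ∋ (a ▷ b)
  ▷-complete x a∈ b∈ f = decidable-stable (_ ∈? proj₁ x) λ ¬m →
    let V , V∈A , acc , b∉V = Pt.refuse x a∈ b∈ ¬m in b∉V (f (V , V∈A) acc)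

  Acc-success : ∀ x {a} → a ∈ S → ∀ y → Accˣ x a y → y ∋ a
  Acc-success x a∈ y acc =
    proj₁ (acc a∈ a∈ (equiv (Pt.▷-id x a∈) (Pt.▷-id x a∈)) (Pt.▷-id x a∈))

  Acc-sound : ∀ x {a b} → a ∈ S → b ∈ S → x ∋ (a ▷ b) → ∀ y → Accˣ x a y → y ∋ b
  Acc-sound x a∈ b∈ m y acc = proj₁ (acc a∈ b∈ (equiv (Pt.▷-id x a∈) (Pt.▷-id x a∈)) m)

  -- The hypotheses put `a ▷ b` and `b ▷ a` in `x`; then `▷-rec` makes every formula equivalent to
  -- `b` equivalent to `a`.
  Acc-recip : ∀ x {a b} → a ∈ S → b ∈ S →
    (∀ y → Accˣ x a y → y ∋ b) → (∀ y → Accˣ x b y → y ∋ a) →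
    ∀ y → Accˣ x a y → Accˣ x b y
  Acc-recip x a∈ b∈ f g y acc d∈ c∈ (equiv bd db) dc =
    acc d∈ c∈ (equiv (Pt.▷-rec x b∈ a∈ d∈ ba ab bd) (Pt.▷-rec x b∈ d∈ a∈ bd db ba)) dc
    where
    ab = ▷-complete x a∈ b∈ f
    ba = ▷-complete x b∈ a∈ g

  -- A larger world contains more conditionals and so demands more of its successors.
  Acc-antitone : ∀ {x x′} → proj₁ x ≼ proj₁ x′ → ∀ {a} → a ∈ S → ∀ y → Accˣ x′ a y → Accˣ x a y
  Acc-antitone x≼x′ a∈ y acc d∈ c∈ (equiv ad da) dc =
    acc d∈ c∈ (equiv (x≼x′ (▷∈L a∈ d∈) ad) (x≼x′ (▷∈L d∈ a∈) da)) (x≼x′ (▷∈L d∈ c∈) dc)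

  -- The conditionals witnessing both equivalence and demand at `x` are kept in `y`, where they make
  -- the same demand of `z`.
  Acc-trans : ∀ {x y z a} → a ∈ S → Accˣ x a y → Accˣ y a z → Accˣ x a z
  Acc-trans {x} a∈ xy yz d∈ c∈ (equiv ad da) dc =
    yz d∈ c∈ (equiv (proj₂ (xy a∈ d∈ (equiv aa aa) ad)) (proj₂ (xy d∈ a∈ (equiv ad da) da)))
       (proj₂ (xy d∈ c∈ (equiv ad da) dc))
    where aa = Pt.▷-id x a∈

  -- The conclusions of `Acc` are decidable memberships, so a double negation can be pushed inwards
  -- to them.
  Acc-stable : ∀ {x a y} → ¬ ¬ Accˣ x a y → Accˣ x a y
  Acc-stable {y = y} ¬¬acc d∈ c∈ e m =
    decidable-stable ((_ ∈? proj₁ y) ×-dec (_ ∈? proj₁ y)) λ ¬c →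
      ¬¬acc λ acc → ¬c (acc d∈ c∈ e m)

  -- Extending accessibility to arbitrary upsets

  Xˡ : Set ℓ
  Xˡ = Lift ℓ Point

  _≤ˡ_ : Xˡ → Xˡ → Set ℓ
  lift x ≤ˡ lift y = Lift ℓ (proj₁ x ≼ proj₁ y)

  ≤ˡ-refl : ∀ {x} → x ≤ˡ x
  ≤ˡ-refl = lift λ _ m → m

  ≤ˡ-trans : ∀ {x y z} → x ≤ˡ y → y ≤ˡ z → x ≤ˡ z
  ≤ˡ-trans (lift f) (lift g) = lift λ l m → g l (f l m)

  -- f x c ⊆ u ⊆ ĉ, where f x c = Accˣ x c and ĉ is the set of points containing c.
  Fits : Xˡ → (Xˡ → Set ℓ) → Formula → Set ℓ
  Fits (lift x) u c =
    (∀ y → Accˣ x c y → u (lift y)) × (∀ y → u y → Lift ℓ (lower y ∋ c))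

  -- R extends the canonical accessibility to all upsets: it is Accˣ x c if some c fits u,
  -- and u itself otherwise.
  Rˡ : Upset Xˡ _≤ˡ_ → Xˡ → Xˡ → Set ℓ
  Rˡ u x y = pred u y ×
    (∀ c → c ∈ S → Fits x (pred u) c → Lift ℓ (Accˣ (lower x) c (lower y)))

  -- The inclusions through `v` and `u` show that `c`-successors contain `d` and conversely. Taking
  -- `u` equal to `v` gives independence of the fitting formula.
  Fits-recip : ∀ {x u v c d} → c ∈ S → d ∈ S →
    (∀ y → Accˣ (lower x) c y → v (lift y)) → Fits x v d →
    (∀ y → Accˣ (lower x) d y → u (lift y)) → Fits x u c →
    ∀ y → Accˣ (lower x) c y → Accˣ (lower x) d y
  Fits-recip {x} c∈ d∈ c⊆v (_ , v⊆d) d⊆u (_ , u⊆c) =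
    Acc-recip (lower x) c∈ d∈
      (λ y acc → lower (v⊆d _ (c⊆v y acc))) (λ y acc → lower (u⊆c _ (d⊆u y acc)))

  -- All formulas fitting `u` have the same successors, so satisfying one fitting formula satisfies
  -- them all.
  Acc⊆R : ∀ {x} u {c} → c ∈ S → Fits x (pred u) c → ∀ y → Accˣ (lower x) c y → Rˡ u x (lift y)
  Acc⊆R {x} u c∈ fit y acc = proj₁ fit y acc , λ d d∈ fit′ →
    lift (Fits-recip {x} {pred u} {pred u} c∈ d∈ (proj₁ fit) fit′ (proj₁ fit′) fit y acc)

  Fits-antitone : ∀ {x y} u {c} → c ∈ S → x ≤ˡ y → Fits x u c → Fits y u c
  Fits-antitone {x} {y} u c∈ (lift x≼y) (f , g) =
    (λ z acc → f z (Acc-antitone {lower x} {lower y} x≼y c∈ z acc)) , g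

  -- The goal Accˣ is stable, so whether some formula fits a may be decided classically; if
  -- none does, then R a x = a.
  R-recip : ∀ a b x → (∀ y → Rˡ a x y → pred b y) → (∀ y → Rˡ b x y → pred a y) →
    ∀ y → Rˡ a x y → Rˡ b x y
  R-recip a b x Ra⊆b Rb⊆a y aRy = Ra⊆b y aRy , λ c c∈ fit → lift (reach c c∈ fit)
    where
    module _ c (c∈ : c ∈ S) (fit : Fits x (pred b) c) where
      c⊆a : ∀ z → Accˣ (lower x) c z → pred a (lift z)
      c⊆a z acc = Rb⊆a (lift z) (Acc⊆R {x} b c∈ fit z acc)

      fitted : ∀ d → d ∈ S → Fits x (pred a) d → Accˣ (lower x) c (lower y)
      fitted d d∈ fit′ = Fits-recip {x} {pred a} {pred b} d∈ c∈
        (λ z acc → Ra⊆b (lift z) (Acc⊆R {x} a d∈ fit′ z acc)) fit c⊆a fit′ (lower y)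
        (lower (proj₂ aRy d d∈ fit′))

      reach : Accˣ (lower x) c (lower y)
      -- If the goal fails, `fitted` shows that nothing fits `a`. Every point of `a` is then a
      -- successor, hence lies in `b` and contains `c`; so `c` itself fits `a`, a contradiction.
      reach = Acc-stable {lower x} {c} {lower y} λ ¬g → ¬g (fitted c c∈
        (c⊆a , λ z az → proj₂ fit z (Ra⊆b z (az , λ d d∈ fit′ →
          ⊥-elim (¬g (fitted d d∈ fit′))))))

  -- The parameter supplies nonemptiness; `completeness` instantiates it with a world omitting `φ₀`.
  module _ (x₀ : Point) where

    frame : Frame ℓ
    frame = record
      { X = Xˡ
      ; point = lift x₀
      ; _≤_ = _≤ˡ_
      ; ≤-refl = λ {x} → ≤ˡ-refl {x}
      ; ≤-trans = λ {x} {y} {z} → ≤ˡ-trans {x} {y} {z}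
      ; R = Rˡ
      ; R-ext = λ a b a≐b x y → ext a b a≐b x y , ext b a (λ z → proj₂ (a≐b z) , proj₁ (a≐b z)) x y
      ; R-mono = λ a {x} {y} {z} x≤y (az , f) →
          -- The witness is `z` itself: whatever fits at `x` fits at the larger `y`.
          z , (az , λ c c∈ fit → lift (Acc-antitone {lower x} {lower y} (lower x≤y) c∈ (lower z)
                (lower (f c c∈ (Fits-antitone {x} {y} (pred a) c∈ x≤y fit))))) , ≤ˡ-refl {z}
      }
      where
      ext : ∀ (a b : Upset Xˡ _≤ˡ_) → pred a ≐ pred b → ∀ x y → Rˡ a x y → Rˡ b x y
      ext a b a≐b x y (ay , f) = proj₁ (a≐b y) ay , λ c c∈ (g , h) →
        f c c∈ ((λ z acc → proj₂ (a≐b _) (g z acc)) , λ z az → h z (proj₁ (a≐b z) az))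

    isICBFrame : IsICBFrame frame
    isICBFrame = record
      { cautious = record
        { success = λ a x y → proj₁
        -- A case of reciprocity: the image under `b` lies in `b`, hence in `a`.
        ; cm = λ a b x Ra⊆b b⊆a → same a b x Ra⊆b (λ y → b⊆a y ∘ proj₁)
        }
      ; recip = same
      ; trans4 = λ a {x} {y} {z} (ay , f) (az , g) →
          z , (az , λ c c∈ fit →
            -- Since `y` is a `c`-successor of `x`, transitivity puts the `c`-successors of `y`
            -- among those of `x`, so `c` fits at `y` too.
            let xy = lower (f c c∈ fit)
                fit-y : Fits y (pred a) c
                fit-y = (λ w yw → proj₁ fit w (Acc-trans {lower x} {lower y} {w} {c} c∈ xy yw)) , proj₂ fit
            in lift (Acc-trans {lower x} {lower y} {lower z} {c} c∈ xy (lower (g c c∈ fit-y)))) ,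
          ≤ˡ-refl {z}
      }
      where
      same : ∀ a b x → (∀ y → Rˡ a x y → pred b y) → (∀ y → Rˡ b x y → pred a y) →
             ↑ frame (Rˡ a x) ≐ ↑ frame (Rˡ b x)
      same a b x f g y =
        (λ (s , aRs , s≤y) → s , R-recip a b x f g s aRs , s≤y) ,
        (λ (s , bRs , s≤y) → s , R-recip b a x g f s bRs , s≤y)

    -- Only variables in S may be used, since ≼ ignores formulas outside L.
    valuation : Valuation frame
    valuation n = record
      { pred = λ x → Lift ℓ (var n ∈ S × lower x ∋ var n)
      ; upward = λ (lift x≼y) (lift (n∈S , m)) → lift (n∈S , x≼y (S⊆L n∈S) m)
      }

    -- Truth lemma and completeness

    truth : ∀ φ → φ ∈ S → ∀ x →
      (sat frame valuation φ x → lower x ∋ φ) × (lower x ∋ φ → sat frame valuation φ x)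
    truth (var n) φ∈S x = (λ s → proj₂ (lower s)) , λ m → lift (φ∈S , m)
    truth ⊥' φ∈S x = (λ ()) , λ m → ⊥-elim (Pt.local (lower x) φ∈S m)
    truth (a ∧' b) φ∈S x =
      (λ (s , t) → proj₂ local (proj₁ truth-a s , proj₁ truth-b t)) ,
      (λ m → let s , t = proj₁ local m in proj₂ truth-a s , proj₂ truth-b t)
      where
      local = Pt.local (lower x) φ∈S
      truth-a = truth a (left∈S a b there φ∈S) x
      truth-b = truth b (right∈S a b there φ∈S) x
    truth (a ∨' b) φ∈S x =
      (λ s → proj₂ local ([ inj₁ ∘ proj₁ truth-a , inj₂ ∘ proj₁ truth-b ] s)) ,
      (λ m → [ inj₁ ∘ proj₂ truth-a , inj₂ ∘ proj₂ truth-b ] (proj₁ local m))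
      where
      local = Pt.local (lower x) φ∈S
      truth-a = truth a (left∈S a b there φ∈S) x
      truth-b = truth b (right∈S a b there φ∈S) x
    truth (a ⇒ b) φ∈S x =
      (λ s → decidable-stable (_ ∈? proj₁ (lower x)) λ ¬m →
        let V , V∈A , x≼V , a∈V , b∉V = proj₂ (Pt.local (lower x) φ∈S) ¬m
            y = lift (V , V∈A)
        in b∉V (proj₁ (truth-b y) (s y (lift x≼V) (proj₂ (truth-a y) a∈V)))) ,
      (λ m y (lift x≼y) s → proj₂ (truth-b y)
        (proj₁ (Pt.local (lower y) φ∈S) (x≼y (S⊆L φ∈S) m) (proj₁ (truth-a y) s)))
      where
      truth-a = truth a (left∈S a b there φ∈S)
      truth-b = truth b (right∈S a b there φ∈S)
    truth (a ▷ b) φ∈S x =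
      (λ s → ▷-complete (lower x) a∈ b∈ λ y acc →
        proj₁ (truth-b (lift y)) (s (lift y) (Acc⊆R {x} (⟦_⟧ frame valuation a) a∈ fit y acc))) ,
      (λ m y (_ , f) → proj₂ (truth-b y)
        (Acc-sound (lower x) a∈ b∈ m (lower y) (lower (f a a∈ fit))))
      where
      a∈ = left∈S a b there φ∈S
      b∈ = right∈S a b there φ∈S
      truth-a = truth a a∈
      truth-b = truth b b∈
      -- By induction the truth set of `a` is the set of points containing `a`, so `a` fits it and
      -- `Rˡ` there is canonical accessibility.
      fit : Fits x (sat frame valuation a) a
      fit = (λ y acc → proj₂ (truth-a (lift y)) (Acc-success (lower x) a∈ y acc)) ,
            (λ y s → lift (proj₁ (truth-a y) s))

  completeness : (∀ (F : Frame ℓ) → IsICBFrame F → Valid F φ₀) → ICB⊢ φ₀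
  completeness valid with lindenbaum covers [] φ₀
  ... | inj₁ d = discharge d
  ... | inj₂ (V , V∈A , _ , φ₀∉V) = ⊥-elim (φ₀∉V (proj₁ (truth x₀ φ₀ (sub-refl φ₀) (lift x₀))
          (valid (frame x₀) (isICBFrame x₀) (valuation x₀) (lift x₀))))
    where
    x₀ : Point
    x₀ = V , V∈A

theorem6p11 : ∀ {ℓ : Level} (φ : Formula) →
    (ICB⊢ φ) ⇔ (∀ (F : Frame ℓ) → IsICBFrame F → Valid F φ)
theorem6p11 {ℓ} φ = mk⇔ (λ d F icb → Soundness.soundness F icb d) (Canonical.completeness φ ℓ)
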